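{- Let $m,n_1,n_2\in\mathbb N$ and $M\in{\rm Mat}_m(\mathbb Z)$. Then $\Gamma_{M,\,n_1}$ embeds in $\Gamma_{M,\,n_1n_2}$ as an induced subgraph; that is, there is an injective map $f:V(\Gamma_{M,\,n_1})\to V(\Gamma_{M,\,n_1n_2})$ such that for all ${\bf x},{\bf y}$, $({\bf x},{\bf y})$ is an arc of $\Gamma_{M,\,n_1}$ if and only if $(f({\bf x}),f({\bf y}))$ is an arc of $\Gamma_{M,\,n_1n_2}$.
   Context: $\mathbb N$ is the set of positive integers and $\mathbb Z_n$ the integers modulo $n$. For $M\in{\rm Mat}_m(\mathbb Z)$, the move graph $\Gamma_{M,\,n}$ is the directed graph with vertex set $\mathbb Z_n^m$ and arc set $\{({\bf x},{\bf y}) : {\bf y}^T=M{\bf x}^T \text{ in } \mathbb Z_n^m\}$ (loops allowed). -}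

module Defs where

open import Algebra.Bundles using (CommutativeRing)
import Algebra.Properties.Semiring.Sum as Sum
open import Data.Integer.Base as ℤ using (ℤ; +_; 0ℤ; 1ℤ)
import Data.Integer.Properties as ℤ
open import Data.Integer.Divisibility.Signed
  using (_∣_; divides; ∣m∣n⇒∣m+n; ∣n⇒∣m*n; ∣m⇒∣-m)
open import Data.Integer.Tactic.RingSolver using (solve-∀)
open import Data.Nat.Base using (ℕ)
open import Data.Product.Base using (_,_; Σ-syntax)
open import Data.Vec.Functional using (Vector)
import Data.Vec.Functional.Relation.Binary.Equality.Setoid as Pointwise
open import Function.Bundles using (Injection; _⇔_)
open import Level using (0ℓ)
open import Relation.Binary.Bundles using (Setoid)
open import Relation.Binary.Core using (Rel)
open import Relation.Binary.Definitions using (_Respects₂_)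
open import Relation.Binary.PropositionalEquality using (_≡_; refl; subst)

Matrix : Set → ℕ → ℕ → Set
Matrix A k m = Vector (Vector A m) k

-- The quotient is a setoid: elements are represented by integers, and
-- two integers are equal in ℤ/ n when n divides their difference.

infix 4 _≡_mod_

_≡_mod_ : ℤ → ℤ → ℕ → Set
a ≡ b mod n = + n ∣ (a ℤ.- b)

private
  module _ {n : ℕ} where

    mod-reflexive : ∀ {a b} → a ≡ b → a ≡ b mod n
    mod-reflexive {a} refl = divides 0ℤ (ℤ.+-inverseʳ a)

    mod-sym : ∀ {a b} → a ≡ b mod n → b ≡ a mod n
    mod-sym {a} {b} p = subst (+ n ∣_) (eq a b) (∣m⇒∣-m p)
      where
      eq : ∀ a b → ℤ.- (a ℤ.- b) ≡ b ℤ.- a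
      eq = solve-∀

    mod-trans : ∀ {a b c} → a ≡ b mod n → b ≡ c mod n → a ≡ c mod n
    mod-trans {a} {b} {c} p q = subst (+ n ∣_) (eq a b c) (∣m∣n⇒∣m+n p q)
      where
      eq : ∀ a b c → (a ℤ.- b) ℤ.+ (b ℤ.- c) ≡ a ℤ.- c
      eq = solve-∀

    mod-+-cong : ∀ {a b c d} → a ≡ b mod n → c ≡ d mod n →
                 a ℤ.+ c ≡ b ℤ.+ d mod n
    mod-+-cong {a} {b} {c} {d} p q =
      subst (+ n ∣_) (eq a b c d) (∣m∣n⇒∣m+n p q)
      where
      eq : ∀ a b c d → (a ℤ.- b) ℤ.+ (c ℤ.- d) ≡ (a ℤ.+ c) ℤ.- (b ℤ.+ d)
      eq = solve-∀

    mod-*-cong : ∀ {a b c d} → a ≡ b mod n → c ≡ d mod n →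
                 a ℤ.* c ≡ b ℤ.* d mod n
    mod-*-cong {a} {b} {c} {d} p q =
      subst (+ n ∣_) (eq a b c d) (∣m∣n⇒∣m+n (∣n⇒∣m*n c p) (∣n⇒∣m*n b q))
      where
      eq : ∀ a b c d →
           c ℤ.* (a ℤ.- b) ℤ.+ b ℤ.* (c ℤ.- d) ≡ a ℤ.* c ℤ.- b ℤ.* d
      eq = solve-∀

    mod-neg-cong : ∀ {a b} → a ≡ b mod n → ℤ.- a ≡ ℤ.- b mod n
    mod-neg-cong {a} {b} p = subst (+ n ∣_) (eq a b) (∣m⇒∣-m p)
      where
      eq : ∀ a b → ℤ.- (a ℤ.- b) ≡ (ℤ.- a) ℤ.- (ℤ.- b)
      eq = solve-∀

ℤ/_ : ℕ → CommutativeRing 0ℓ 0ℓ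
ℤ/ n = record
  { Carrier = ℤ
  ; _≈_     = λ a b → a ≡ b mod n
  ; _+_     = ℤ._+_
  ; _*_     = ℤ._*_
  ; -_      = ℤ.-_
  ; 0#      = 0ℤ
  ; 1#      = 1ℤ
  ; isCommutativeRing = record
    { isRing = record
      { +-isAbelianGroup = record
        { isGroup = record
          { isMonoid = record
            { isSemigroup = record
              { isMagma = record
                { isEquivalence = record
                  { refl  = λ {a} → mod-reflexive {n} {a} refl
                  ; sym   = λ {a} {b} → mod-sym {n} {a} {b}
                  ; trans = λ {a} {b} {c} → mod-trans {n} {a} {b} {c}
                  }
                ; ∙-cong = λ {a} {b} {c} {d} → mod-+-cong {n} {a} {b} {c} {d}
                }
              ; assoc = λ a b c → mod-reflexive (ℤ.+-assoc a b c)
              }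
            ; identity = (λ a → mod-reflexive (ℤ.+-identityˡ a))
                       , (λ a → mod-reflexive (ℤ.+-identityʳ a))
            }
          ; inverse = (λ a → mod-reflexive (ℤ.+-inverseˡ a))
                    , (λ a → mod-reflexive (ℤ.+-inverseʳ a))
          ; ⁻¹-cong = λ {a} {b} → mod-neg-cong {n} {a} {b}
          }
        ; comm = λ a b → mod-reflexive (ℤ.+-comm a b)
        }
      ; *-cong = λ {a} {b} {c} {d} → mod-*-cong {n} {a} {b} {c} {d}
      ; *-assoc = λ a b c → mod-reflexive (ℤ.*-assoc a b c)
      ; *-identity = (λ a → mod-reflexive (ℤ.*-identityˡ a))
                   , (λ a → mod-reflexive (ℤ.*-identityʳ a))
      ; distrib = (λ a b c → mod-reflexive (ℤ.*-distribˡ-+ a b c))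
                , (λ a b c → mod-reflexive (ℤ.*-distribʳ-+ a b c))
      }
    ; *-comm = λ a b → mod-reflexive (ℤ.*-comm a b)
    }
  }

-- The canonical projection; it is the identity on representatives.
residue : (n : ℕ) → ℤ → CommutativeRing.Carrier (ℤ/ n)
residue n a = a

module _ (R : CommutativeRing 0ℓ 0ℓ) where
  open CommutativeRing R hiding (refl)
  open Sum semiring using (sum-syntax; sum-cong-≋)
  open Pointwise setoid using (_≋_; ≋-setoid)

  vectors : ℕ → Setoid 0ℓ 0ℓ
  vectors m = ≋-setoid m

  mulVec : ∀ {k m} → Matrix Carrier k m → Vector Carrier m → Vector Carrier k
  mulVec {m = m} A x i = ∑[ j < m ] (A i j * x j)

  mulVec-cong : ∀ {k m} (A : Matrix Carrier k m) {x y : Vector Carrier m} →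
                x ≋ y → mulVec A x ≋ mulVec A y
  mulVec-cong A x≋y i = sum-cong-≋ (λ j → *-congˡ (x≋y j))

record Digraph : Set₁ where
  field
    vertices : Setoid 0ℓ 0ℓ
  open Setoid vertices public using (_≈_) renaming (Carrier to Vertex)
  field
    Arc      : Rel Vertex 0ℓ
    Arc-resp : Arc Respects₂ _≈_

open Digraph

EmbedsAsInducedSubgraph : Digraph → Digraph → Set
EmbedsAsInducedSubgraph G H =
  Σ[ f ∈ Injection (vertices G) (vertices H) ]
    let open Injection f using (to) in
    ∀ (x y : Vertex G) → Arc G x y ⇔ Arc H (to x) (to y)

moveGraph : ∀ {m} → Matrix ℤ m m → ℕ → Digraph
moveGraph {m} M n = record
  { vertices = V
  ; Arc      = λ x y → y ≈ᵛ mulVec (ℤ/ n) Mₙ x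
  ; Arc-resp = (λ {x} {y} {z} y≈z y≈Mx →
                  V.trans {z} {y} {mulVec (ℤ/ n) Mₙ x}
                    (V.sym {y} {z} y≈z) y≈Mx)
             , (λ {y} {x} {z} x≈z y≈Mx →
                  V.trans {y} {mulVec (ℤ/ n) Mₙ x} {mulVec (ℤ/ n) Mₙ z}
                    y≈Mx (mulVec-cong (ℤ/ n) Mₙ {x} {z} x≈z))
  }
  where
  V : Setoid 0ℓ 0ℓ
  V = vectors (ℤ/ n) m
  module V = Setoid V
  open V using () renaming (_≈_ to _≈ᵛ_)
  Mₙ : Matrix (CommutativeRing.Carrier (ℤ/ n)) m m
  Mₙ i j = residue n (M i j)

{-# OPTIONS --safe #-}
module Submission where

open import Defs
open import Algebra.Bundles using (CommutativeRing)
import Algebra.Properties.Semiring.Sum as Sum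
open import Data.Integer.Base as ℤ using (ℤ; +_)
open import Data.Integer.Divisibility.Signed using (_∣_; *-monoˡ-∣; *-cancelʳ-∣)
open import Data.Integer.Properties using (pos-*)
open import Data.Integer.Tactic.RingSolver using (solve-∀)
open import Data.Nat.Base using (ℕ; NonZero; _*_)
open import Data.Product.Base using (_,_)
open import Data.Vec.Functional using (Vector; map)
open import Function.Bundles using (mk⇔)
open import Level using (0ℓ)
open import Relation.Binary.PropositionalEquality using (_≡_; sym; subst₂)

-- Multiplication by n₂ is a well-defined injection ℤ/n₁ → ℤ/n₁n₂, and,
-- applied coordinatewise, it commutes with M because M is linear.

-- For nonzero `n₂`, `n₁` divides `d` exactly when `n₁ * n₂` divides `d` times `n₂`. So two vectors
-- agree mod `n₁` iff their multiples by `n₂` agree mod `n₁ * n₂` (`mod-scale`, `mod-unscale`).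
-- Applied to two vertices, this gives well-definedness and injectivity; applied to `y` and the
-- product of `M` with `x`, it gives both directions for arcs, by `mulVec-scale`.

module _ (R : CommutativeRing 0ℓ 0ℓ) where
  open CommutativeRing R using (Carrier; _≈_; trans; *-assoc; semiring)
    renaming (_*_ to _·_; sym to ≈-sym)
  open Sum semiring using (sum-cong-≋; *-distribʳ-sum)

  -- With `c` on the right, associativity frees it from each term and distributivity pulls it out of
  -- the row sum.
  mulVec-scale : ∀ {k m} (A : Matrix Carrier k m) (x : Vector Carrier m) c i →
                 mulVec R A (map (_· c) x) i ≈ mulVec R A x i · c
  mulVec-scale A x c i =
    trans (sum-cong-≋ (λ j → ≈-sym (*-assoc (A i j) (x j) c)))
          (≈-sym (*-distribʳ-sum c (λ j → A i j · x j)))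

*-distribʳ-minus : ∀ c a b → (a ℤ.- b) ℤ.* c ≡ a ℤ.* c ℤ.- b ℤ.* c
*-distribʳ-minus = solve-∀

module _ (n k : ℕ) {a b : ℤ} where

  mod-scale : a ≡ b mod n → a ℤ.* + k ≡ b ℤ.* + k mod (n * k)
  mod-scale a≡b =
    subst₂ _∣_ (sym (pos-* n k)) (*-distribʳ-minus (+ k) a b)
      (*-monoˡ-∣ (+ k) a≡b)

  -- The factor `+ k` cancels from both sides of the divisibility; for `k` zero the premise would be
  -- `0 ∣ 0`, true for all `a` and `b`.
  mod-unscale : .{{_ : NonZero k}} →
                a ℤ.* + k ≡ b ℤ.* + k mod (n * k) → a ≡ b mod n
  mod-unscale ak≡bk =
    *-cancelʳ-∣ (+ k) (subst₂ _∣_ (pos-* n k) (sym (*-distribʳ-minus (+ k) a b)) ak≡bk)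

theorem3p3 : (m n₁ n₂ : ℕ) .{{_ : NonZero m}} .{{_ : NonZero n₁}} .{{_ : NonZero n₂}}
    (M : Matrix ℤ m m) →
    EmbedsAsInducedSubgraph (moveGraph M n₁) (moveGraph M (n₁ * n₂))
theorem3p3 m n₁ n₂ M = record
  { to        = scale
  ; cong      = λ {x} {y} x≈y i → mod-scale n₁ n₂ {x i} {y i} (x≈y i)
  ; injective = λ {x} {y} x≈y i → mod-unscale n₁ n₂ {x i} {y i} (x≈y i)
  } , λ x y → mk⇔
    (λ y≈Mx i → trans {scale y i} {Mx x i ℤ.* + n₂} {Mx (scale x) i}
      (mod-scale n₁ n₂ {y i} {Mx x i} (y≈Mx i))
      (≈-sym {Mx (scale x) i} {Mx x i ℤ.* + n₂} (Mx-scale x i)))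
    -- `Mx (scale x)` must first become a visible multiple of `n₂`, so that `n₂` can be cancelled.
    (λ y≈Mx i → mod-unscale n₁ n₂ {y i} {Mx x i}
      (trans {scale y i} {Mx (scale x) i} {Mx x i ℤ.* + n₂} (y≈Mx i) (Mx-scale x i)))
  where
  R : CommutativeRing 0ℓ 0ℓ
  R = ℤ/ (n₁ * n₂)
  open CommutativeRing R using (trans) renaming (sym to ≈-sym)

  scale : Vector ℤ m → Vector ℤ m
  scale = map (ℤ._* + n₂)

  -- Row sums are formed on integer representatives, so the modulus is immaterial here.
  Mx : Vector ℤ m → Vector ℤ m
  Mx = mulVec R M

  Mx-scale : ∀ x i → Mx (scale x) i ≡ Mx x i ℤ.* + n₂ mod (n₁ * n₂)
  Mx-scale x = mulVec-scale R M x (+ n₂)
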